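{- For every integer $k\ge 2$, the following hold. (i) There exists a graph $G_k$ such that $\eta(G_k)=1$ and $\eta_\ell(G_k)\ge k$. (ii) There exists a regular graph $H_k$ such that $\eta(H_k)=2$ and $\eta_\ell(H_k)\ge k$.
   Context: All graphs are finite and simple. $\mathbb N$ denotes the positive integers and $[k]=\{1,2,\ldots,k\}$. For a graph $G$ and a labeling $\ell:V(G)\to\mathbb N$, put $S_\ell(v)=\sum_{w\in N(v)}\ell(w)$, where $N(v)$ is the open neighborhood of $v$. The labeling $\ell$ is an additive labeling if $S_\ell(u)\ne S_\ell(v)$ for every edge $uv\in E(G)$. The additive number $\eta(G)$ is the least positive integer $k$ such that $G$ has an additive labeling $\ell:V(G)\to[k]$. The list additive number $\eta_\ell(G)$ is the least positive integer $k$ such that for every assignment of $k$-element lists $L(v)\subset\mathbb N$ to the vertices $v\in V(G)$ there is an additive labeling $\ell$ of $G$ with $\ell(v)\in L(v)$ for every vertex $v$. (The subscript in $\eta_\ell(G)$ is only notation and does not refer to a particular labeling.) -}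

module Defs where

open import Data.Fin using (Fin)
open import Data.List using (List; allFin; filter; length; map)
open import Data.List.Membership.Propositional using (_∈_)
open import Data.List.Relation.Unary.All using (All)
open import Data.List.Relation.Unary.Unique.Propositional using (Unique)
open import Data.Nat using (ℕ; _≤_)
open import Data.Nat.ListAction using (sum)
open import Data.Nat.Properties using (≤-trans)
open import Data.Product using (∃-syntax; _×_; _,_)
open import Function.Bundles using (_⇔_; mk⇔)
open import Level using (0ℓ)
open import Relation.Binary.Core using (Rel)
open import Relation.Binary.Definitions using (Symmetric; Irreflexive; Decidable)
open import Relation.Binary.PropositionalEquality using (_≡_; _≢_)

record Graph : Set₁ where
  field
    order    : ℕ
    _~_      : Rel (Fin order) 0ℓ
    _~?_     : Decidable _~_
    ~-sym    : Symmetric _~_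
    ~-irrefl : Irreflexive _≡_ _~_

  Vertex : Set
  Vertex = Fin order

  N : Vertex → List Vertex
  N v = filter (v ~?_) (allFin order)

  degree : Vertex → ℕ
  degree v = length (N v)

  S : (Vertex → ℕ) → Vertex → ℕ
  S ℓ v = sum (map ℓ (N v))

  IsAdditive : (Vertex → ℕ) → Set
  IsAdditive ℓ = ∀ u v → u ~ v → S ℓ u ≢ S ℓ v

Regular : Graph → Set
Regular G = ∃[ d ] (∀ v → degree v ≡ d)
  where open Graph G

-- Labels are positive integers; here ℕ contains 0, so positivity is stated explicitly.
HasAdditiveLabeling : Graph → ℕ → Set
HasAdditiveLabeling G k =
  ∃[ ℓ ] ((∀ v → 1 ≤ ℓ v × ℓ v ≤ k) × IsAdditive ℓ)
  where open Graph G

-- xs enumerates, without repetition, a k-element set of positive integers.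
record IsLabelList (k : ℕ) (xs : List ℕ) : Set where
  field
    size     : length xs ≡ k
    distinct : Unique xs
    positive : All (1 ≤_) xs

HasListAdditiveLabelings : Graph → ℕ → Set
HasListAdditiveLabelings G k =
  (L : Vertex → List ℕ) → (∀ v → IsLabelList k (L v)) →
  ∃[ ℓ ] ((∀ v → ℓ v ∈ L v) × IsAdditive ℓ)
  where open Graph G

record IsLeastPositive (P : ℕ → Set) (m : ℕ) : Set where
  field
    isPositive : 1 ≤ m
    holds      : P m
    least      : ∀ j → 1 ≤ j → P j → m ≤ j

-- "The least positive integer satisfying P exists and is at least k", for a P that
-- need not be decidable, so that the minimum itself cannot be computed constructively:
-- some positive integer satisfies P, and each one that does is at least k.
record LeastPositive≥ (P : ℕ → Set) (k : ℕ) : Set where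
  field
    inhabited  : ∃[ m ] (1 ≤ m × P m)
    lowerBound : ∀ j → 1 ≤ j → P j → k ≤ j

leastPositive≥⇔ : ∀ {P m} → IsLeastPositive P m → ∀ k → LeastPositive≥ P k ⇔ k ≤ m
leastPositive≥⇔ {m = m} p k = mk⇔
  (λ q → LeastPositive≥.lowerBound q m isPositive holds)
  (λ k≤m → record
    { inhabited  = m , isPositive , holds
    ; lowerBound = λ j 1≤j Pj → ≤-trans k≤m (least j 1≤j Pj)
    })
  where open IsLeastPositive p

infix 4 η_≡_ ηₗ_≥_

η_≡_ : Graph → ℕ → Set
η G ≡ k = IsLeastPositive (HasAdditiveLabeling G) k

ηₗ_≥_ : Graph → ℕ → Set
ηₗ G ≥ k = LeastPositive≥ (HasListAdditiveLabelings G) k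

{-# OPTIONS --safe #-}
module Submission where

-- Part (i): take a large independent set, the core, and attach to it many cliques of
-- m + 1 vertices, one pair of cliques for every guess g of the labels on the core.  In a
-- clique vertex v the sum S v is the weight of the core neighbours, plus the total label of
-- the clique, minus the label of v.  By pigeonhole two clique vertices carry the same label
-- if the lists on the clique are {1, …, m}; so if g is the actual labelling and the core
-- neighbourhoods P g i of the vertices i of its clique all have the same weight under g,
-- then the two sums agree.  Such neighbourhoods exist because the core has three classes
-- with disjoint intervals of m labels: on a majority label v t in each class, choosing
-- s t i vertices from class t balances as soon as Σ s t i * v t does not depend on i.
-- If moreover the sizes ∣P g i∣ are distinct, the all-one labelling is additive.
--
-- Part (ii): with all three classes one can in addition keep Σ s t i independent of i
-- while s 1 i varies, so a label 2 on class 1 separates the clique vertices.  A second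
-- clique attached to the complements of the P g i gives all core vertices the same degree.

-- Part (i): take a large independent set, the core, and attach to it many cliques of
-- m + 1 vertices, one pair of cliques for every guess g of the labels on the core.  In a
-- clique vertex v the sum S v is the weight of the core neighbours, plus the total label of
-- the clique, minus the label of v.  By pigeonhole two clique vertices carry the same label
-- if the lists on the clique are {1, …, m}; so if g is the actual labelling and the core
-- neighbourhoods P g i of the vertices i of its clique all have the same weight under g,
-- then the two sums agree.  Such neighbourhoods exist because the core has three classes
-- with disjoint intervals of m labels: on a majority label v t in each class, choosing
-- s t i vertices from class t balances as soon as Σ s t i * v t does not depend on i.
-- If moreover the sizes ∣P g i∣ are distinct, the all-one labelling is additive.
--
-- Part (ii): with all three classes one can in addition keep Σ s t i independent of i
-- while s 1 i varies, so a label 2 on class 1 separates the clique vertices.  A second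
-- clique attached to the complements of the P g i gives all core vertices the same degree.

import Algebra.Properties.CommutativeMonoid.Sum
open import Data.Bool using (Bool; true; false; not; T; _∧_; if_then_else_)
open import Data.Bool.Properties using (T?)
open import Data.Fin using (Fin; zero; suc; toℕ; _↑ˡ_; _↑ʳ_; combine; remQuot; splitAt; finToFun; funToFin; inject≤; fromℕ<)
open import Data.Fin.Patterns using (0F; 1F; 2F)
import Data.Fin as Fin
import Data.Fin.Properties as Fin
open import Data.List using (List; []; _∷_; length; filter; tabulate; map; lookup)
open import Data.List.Membership.Propositional using (_∈_)
open import Data.List.Membership.Propositional.Properties using (∈-lookup; ∈-tabulate⁻)
open import Data.List.Properties using (length-tabulate)
import Data.List.Relation.Unary.All as All
import Data.List.Relation.Unary.All.Properties as All
open import Data.List.Relation.Unary.AllPairs using (_∷_)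
open import Data.List.Relation.Unary.Unique.Propositional using (Unique)
import Data.List.Relation.Unary.Unique.Propositional.Properties as Unique
open import Data.Nat using (ℕ; zero; suc; _+_; _*_; _∸_; _^_; _≤_; _<_; z≤n; s≤s; s≤s⁻¹; _≟_; >-nonZero)
import Data.Nat.ListAction as List
open import Data.Nat.Properties
open import Data.Nat.Tactic.RingSolver using (solve-∀)
open import Data.Product using (∃-syntax; Σ-syntax; _×_; _,_; proj₁; proj₂; uncurry)
open import Data.Sum using (_⊎_; inj₁; inj₂; [_,_]′; map₂)
open import Data.Unit using (tt)
open import Function using (_∘_; id; const)
open import Relation.Binary using (tri<; tri≈; tri>)
open import Relation.Binary.PropositionalEquality
open import Relation.Nullary using (¬_; Dec; yes; no; does; contradiction)
open import Relation.Nullary.Decidable using (_×-dec_; ¬?; dec-true; dec-false)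
open import Relation.Unary using (Decidable)
open import Defs

open Algebra.Properties.CommutativeMonoid.Sum +-0-commutativeMonoid
  using (sum; sum-syntax; sum-cong-≗; ∑-distrib-+; ∑-comm)

-- Finite sums, weights of Boolean sets, and counting.

infixr 11 _▹_

_▹_ : Bool → ℕ → ℕ
b ▹ x = if b then x else 0

weight : ∀ {n} → (Fin n → Bool) → (Fin n → ℕ) → ℕ
weight Q f = sum λ x → Q x ▹ f x

count : ∀ {n} → (Fin n → Bool) → ℕ
count Q = weight Q (const 1)

sum-const : ∀ n {a} → sum {n} (const a) ≡ n * a
sum-const zero = refl
sum-const (suc n) = cong (_ +_) (sum-const n)

sum-ones : ∀ n → sum {n} (const 1) ≡ n
sum-ones n = trans (sum-const n) (*-identityʳ n)

sum-mono-≤ : ∀ {n} {f g : Fin n → ℕ} → (∀ x → f x ≤ g x) → sum f ≤ sum g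
sum-mono-≤ {zero} f≤g = z≤n
sum-mono-≤ {suc n} f≤g = +-mono-≤ (f≤g zero) (sum-mono-≤ (f≤g ∘ suc))

sum-++ : ∀ m {n} (f : Fin (m + n) → ℕ) →
         sum f ≡ sum (λ x → f (x ↑ˡ n)) + sum (λ y → f (m ↑ʳ y))
sum-++ zero f = refl
sum-++ (suc m) f = trans (cong (f zero +_) (sum-++ m (f ∘ suc))) (sym (+-assoc (f zero) _ _))

sum-combine : ∀ m {n} (f : Fin (m * n) → ℕ) →
              sum f ≡ ∑[ i < m ] ∑[ j < n ] f (combine i j)
sum-combine zero f = refl
sum-combine (suc m) {n} f =
  trans (sum-++ n f) (cong (sum (λ j → f (j ↑ˡ m * n)) +_) (sum-combine m (f ∘ (n ↑ʳ_))))

weight-complement : ∀ {n} (Q : Fin n → Bool) f → weight Q f + weight (not ∘ Q) f ≡ sum f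
weight-complement Q f =
  trans (sym (∑-distrib-+ (λ x → Q x ▹ f x) (λ x → not (Q x) ▹ f x))) (sum-cong-≗ λ x → lemma (Q x))
  where
  lemma : ∀ b {a} → b ▹ a + not b ▹ a ≡ a
  lemma true = +-identityʳ _
  lemma false = refl

weight≤sum : ∀ {n} (Q : Fin n → Bool) f → weight Q f ≤ sum f
weight≤sum Q f = subst (weight Q f ≤_) (weight-complement Q f) (m≤m+n _ _)

weight-const : ∀ {n} (Q : Fin n → Bool) {f a} → (∀ x → Q x ≡ true → f x ≡ a) →
               weight Q f ≡ count Q * a
weight-const {zero} Q eq = refl
weight-const {suc n} Q eq with Q zero in q
... | true = cong₂ _+_ (eq zero q) (weight-const (Q ∘ suc) (eq ∘ suc))
... | false = weight-const (Q ∘ suc) (eq ∘ suc)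

weight-ones : ∀ {n} (Q : Fin n → Bool) (f : Fin n → ℕ) → (∀ x → f x ≡ 1) → weight Q f ≡ count Q
weight-ones Q f f≡1 = sum-cong-≗ λ x → cong (Q x ▹_) (f≡1 x)

weight-cong : ∀ {n} {Q R : Fin n → Bool} {f} → (∀ x → Q x ≡ R x) → weight Q f ≡ weight R f
weight-cong eq = sum-cong-≗ λ x → cong (_▹ _) (eq x)

select : ∀ {n} → (Fin n → Bool) → ℕ → Fin n → Bool
select Q zero _ = false
select Q (suc p) zero = Q zero
select Q (suc p) (suc x) = if Q zero then select (Q ∘ suc) p x else select (Q ∘ suc) (suc p) x

select-⊆ : ∀ {n} (Q : Fin n → Bool) p x → select Q p x ≡ true → Q x ≡ true
select-⊆ Q (suc p) zero eq = eq
select-⊆ Q (suc p) (suc x) eq with Q zero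
... | true = select-⊆ (Q ∘ suc) p x eq
... | false = select-⊆ (Q ∘ suc) (suc p) x eq

count-select : ∀ {n} (Q : Fin n → Bool) {p} → p ≤ count Q → count (select Q p) ≡ p
count-select {n} Q {zero} _ = trans (sum-const n) (*-zeroʳ n)
count-select {suc n} Q {suc p} p≤ with Q zero
... | true = cong suc (count-select (Q ∘ suc) (s≤s⁻¹ p≤))
... | false = count-select (Q ∘ suc) p≤

count-singleton : ∀ {m} (i : Fin m) → count (λ j → does (i Fin.≟ j)) ≡ 1
count-singleton {suc m} zero = cong suc (trans (sum-const m) (*-zeroʳ m))
count-singleton (suc i) = count-singleton i

weight-singleton : ∀ {m} (i : Fin m) (f : Fin m → ℕ) → weight (λ j → does (i Fin.≟ j)) f ≡ f i
weight-singleton i f =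
  trans (weight-const _ {a = f i} same) (trans (cong (_* f i) (count-singleton i)) (*-identityˡ _))
  where
  same : ∀ j → does (i Fin.≟ j) ≡ true → f j ≡ f i
  same j eq with yes refl ← i Fin.≟ j = refl

-- Double counting: the fibres of `f` have total size `n`, so if all had fewer than `M` elements,
-- `n` would be at most `m * M`.
majority : ∀ {m n M} → m * M < n → (f : Fin n → Fin m) →
           ∃[ a ] M ≤ count λ x → does (f x Fin.≟ a)
majority {m} {n} {M} m*M<n f with Fin.any? (λ a → M ≤? count (λ x → does (f x Fin.≟ a)))
... | yes found = found
... | no none = contradiction m*M<n (≤⇒≯ (begin
  n ≡⟨ *-identityʳ n ⟨
  n * 1 ≡⟨ sum-const n ⟨
  (∑[ x < n ] 1) ≡⟨ sum-cong-≗ (λ x → sym (count-singleton (f x))) ⟩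
  (∑[ x < n ] ∑[ a < m ] does (f x Fin.≟ a) ▹ 1) ≡⟨ ∑-comm (λ x a → does (f x Fin.≟ a) ▹ 1) ⟩
  (∑[ a < m ] ∑[ x < n ] does (f x Fin.≟ a) ▹ 1) ≤⟨ sum-mono-≤ (λ a → <⇒≤ (≰⇒> (none ∘ (a ,_)))) ⟩
  (∑[ a < m ] M) ≡⟨ sum-const m ⟩
  m * M ∎))
  where open ≤-Reasoning

sum-filter-tabulate : ∀ {n} {A : Set} {P : A → Set} (P? : Decidable P) (g : A → ℕ) (f : Fin n → A) →
  List.sum (map g (filter P? (tabulate f))) ≡ weight (does ∘ P? ∘ f) (g ∘ f)
sum-filter-tabulate {zero} P? g f = refl
sum-filter-tabulate {suc n} P? g f with does (P? (f zero))
... | true = cong (g (f zero) +_) (sum-filter-tabulate P? g (f ∘ suc))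
... | false = sum-filter-tabulate P? g (f ∘ suc)

length≡sum : ∀ {A : Set} (xs : List A) → length xs ≡ List.sum (map (const 1) xs)
length≡sum [] = refl
length≡sum (_ ∷ xs) = cong suc (length≡sum xs)

-- Choosing labels that keep affine forms distinct.

lookup-injective : ∀ {A : Set} {xs : List A} → Unique xs →
                   ∀ i j → lookup xs i ≡ lookup xs j → i ≡ j
lookup-injective (_ ∷ _) zero zero _ = refl
lookup-injective (x∉ ∷ _) zero (suc j) eq = contradiction eq (All.lookup x∉ (∈-lookup j))
lookup-injective (x∉ ∷ _) (suc i) zero eq = contradiction (sym eq) (All.lookup x∉ (∈-lookup i))
lookup-injective (_ ∷ xs!) (suc i) (suc j) eq = cong suc (lookup-injective xs! i j eq)

-- If every entry were blocked, two of the more than `r` positions would share a blocker, and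
-- `B-unique` would force a repetition in `xs`.
avoid : ∀ {r xs} {B : Fin r → ℕ → Set} → (∀ k x → Dec (B k x)) →
        (∀ k {x y} → B k x → B k y → x ≡ y) → Unique xs → r < length xs →
        ∃[ x ] x ∈ xs × (∀ k → ¬ B k x)
avoid {r} {xs} {B} B? B-unique xs! r<∣xs∣
  with Fin.any? (λ i → Fin.all? (λ k → ¬? (B? k (lookup xs i))))
... | yes (i , good) = lookup xs i , ∈-lookup i , good
... | no none = contradiction i≡j (Fin.<⇒≢ i<j)
  where
  blocker : ∀ i → ∃[ k ] B k (lookup xs i)
  blocker i with Fin.any? (λ k → B? k (lookup xs i))
  ... | yes found = found
  ... | no free = contradiction (i , λ k b → free (k , b)) none
  collision = Fin.pigeonhole r<∣xs∣ (proj₁ ∘ blocker)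
  i = proj₁ collision
  j = proj₁ (proj₂ collision)
  i<j = proj₁ (proj₂ (proj₂ collision))
  i≡j : i ≡ j
  i≡j = lookup-injective xs! i j (B-unique _ (proj₂ (blocker i))
    (subst (λ k → B k (lookup xs j)) (sym (proj₂ (proj₂ (proj₂ collision)))) (proj₂ (blocker j))))

-- With `y` written as `suc (x + d)`, cancelling the values at `x` compares the slopes without
-- subtraction.
affine-agree : ∀ {a b p q x y} → x < y → p + a * x ≡ q + b * x → p + a * y ≡ q + b * y →
               a ≡ b × p ≡ q
affine-agree {a} {b} {p} {q} {x} x<y eq₁ eq₂ with d , refl ← m≤n⇒∃[o]m+o≡n x<y =
  a≡b , +-cancelʳ-≡ (b * x) p q (subst (λ c → p + c * x ≡ _) a≡b eq₁)
  where
  shift : ∀ p a → p + a * suc (x + d) ≡ p + a * x + a * suc d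
  shift p a = trans (cong (p +_) (trans (cong (a *_) (sym (+-suc x d))) (*-distribˡ-+ a x (suc d))))
                    (sym (+-assoc p _ _))
  a≡b : a ≡ b
  a≡b = *-cancelʳ-≡ a b (suc d) (+-cancelˡ-≡ (q + b * x) _ _ (begin
    q + b * x + a * suc d ≡⟨ cong (_+ a * suc d) eq₁ ⟨
    p + a * x + a * suc d ≡⟨ shift p a ⟨
    p + a * suc (x + d) ≡⟨ eq₂ ⟩
    q + b * suc (x + d) ≡⟨ shift q b ⟩
    q + b * x + b * suc d ∎))
    where open ≡-Reasoning

-- The labels are chosen one after another; a choice can make the two affine forms
-- of a pair identical for at most one value, so r pairs exclude at most r values.
separate : ∀ {n r} (α β : Fin r → Fin n → ℕ) (p q : Fin r → ℕ) →
  (∀ k → (∃[ x ] α k x ≢ β k x) ⊎ p k ≢ q k) →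
  (L : Fin n → List ℕ) → (∀ x → Unique (L x) × r < length (L x)) →
  Σ[ ℓ ∈ (Fin n → ℕ) ] (∀ x → ℓ x ∈ L x) ×
         (∀ k → p k + sum (λ x → α k x * ℓ x) ≢ q k + sum (λ x → β k x * ℓ x))
separate {zero} α β p q distinct L ok = (λ ()) , (λ ()) , differ
  where
  differ : ∀ k → p k + 0 ≢ q k + 0
  differ k eq with inj₂ p≢q ← distinct k = p≢q (+-cancelʳ-≡ 0 _ _ eq)
separate {suc n} {r} α β p q distinct L ok =
  extend (avoid bad? bad-unique (proj₁ (ok zero)) (proj₂ (ok zero)))
  where
  -- The chosen label moves into the constant term: `Bad k x` means that the choice `x` leaves the
  -- two forms of pair `k` identical.
  Bad : Fin r → ℕ → Set
  Bad k x = (∀ y → α k (suc y) ≡ β k (suc y)) × p k + α k zero * x ≡ q k + β k zero * x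

  tails? : ∀ k → Dec (∀ y → α k (suc y) ≡ β k (suc y))
  tails? k = Fin.all? λ y → α k (suc y) ≟ β k (suc y)

  bad? : ∀ k x → Dec (Bad k x)
  bad? k x = tails? k ×-dec (p k + α k zero * x ≟ q k + β k zero * x)

  identical : ∀ k {x y} → x < y → Bad k x → ¬ Bad k y
  identical k x<y (tails , eq₁) (_ , eq₂) with affine-agree x<y eq₁ eq₂ | distinct k
  ... | α₀≡β₀ , _ | inj₁ (zero , α₀≢β₀) = α₀≢β₀ α₀≡β₀
  ... | _         | inj₁ (suc y , α≢β) = α≢β (tails y)
  ... | _ , p≡q   | inj₂ p≢q = p≢q p≡q

  bad-unique : ∀ k {x y} → Bad k x → Bad k y → x ≡ y
  bad-unique k {x} {y} bx by with <-cmp x y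
  ... | tri< x<y _ _ = contradiction by (identical k x<y bx)
  ... | tri≈ _ x≡y _ = x≡y
  ... | tri> _ _ y<x = contradiction bx (identical k y<x by)

  remains : ∀ {k x} → ¬ Bad k x →
    (∃[ y ] α k (suc y) ≢ β k (suc y)) ⊎ p k + α k zero * x ≢ q k + β k zero * x
  remains {k} ¬bad with tails? k
  ... | yes tails = inj₂ λ eq → ¬bad (tails , eq)
  ... | no ¬tails = inj₁ (Fin.¬∀⟶∃¬ n _ (λ y → α k (suc y) ≟ β k (suc y)) ¬tails)

  extend : (∃[ x ] x ∈ L zero × (∀ k → ¬ Bad k x)) →
    Σ[ ℓ ∈ (Fin (suc n) → ℕ) ] (∀ y → ℓ y ∈ L y) ×
           (∀ k → p k + sum (λ y → α k y * ℓ y) ≢ q k + sum (λ y → β k y * ℓ y))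
  extend (x , x∈ , good)
    with ℓ , ℓ∈ , differ ← separate (λ k → α k ∘ suc) (λ k → β k ∘ suc)
           (λ k → p k + α k zero * x) (λ k → q k + β k zero * x)
           (λ k → remains (good k)) (L ∘ suc) (ok ∘ suc)
    = (λ { zero → x ; (suc y) → ℓ y })
    , (λ { zero → x∈ ; (suc y) → ℓ∈ y })
    , λ k eq → differ k (trans (+-assoc (p k) _ _) (trans eq (sym (+-assoc (q k) _ _))))

-- Existence of a sufficient list length.

module _ (G : Graph) where
  open Graph G

  adjacent : Vertex → Vertex → Bool
  adjacent v w = does (v ~? w)

  S-weight : ∀ ℓ v → S ℓ v ≡ weight (adjacent v) ℓ
  S-weight ℓ v = sum-filter-tabulate (v ~?_) ℓ id

  degree≡S : ∀ v → degree v ≡ S (const 1) v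
  degree≡S v = length≡sum (N v)

  -- Provides the witness that `LeastPositive≥` asks for. Each ordered pair of vertices yields one
  -- pair of forms, hence lists one longer than `order * order`.
  large-lists : HasListAdditiveLabelings G (suc (order * order))
  large-lists L ok = conclude (separate
    (λ e w → adjacent (proj₁ (edge e)) w ▹ 1)
    (λ e w → adjacent (proj₂ (edge e)) w ▹ 1)
    (const 0) (λ e → gap (proj₁ (edge e)) (proj₂ (edge e)))
    (λ e → distinct (proj₁ (edge e)) (proj₂ (edge e))) L
    (λ v → IsLabelList.distinct (ok v) , ≤-reflexive (sym (IsLabelList.size (ok v)))))
    where
    edge : Fin (order * order) → Vertex × Vertex
    edge = remQuot order

    dot : Vertex → (Vertex → ℕ) → ℕ
    dot v ℓ = sum λ w → (adjacent v w ▹ 1) * ℓ w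

    dot≡S : ∀ ℓ v → dot v ℓ ≡ S ℓ v
    dot≡S ℓ v = trans (sum-cong-≗ λ w → scale (adjacent v w)) (sym (S-weight ℓ v))
      where
      scale : ∀ b {x} → (b ▹ 1) * x ≡ b ▹ x
      scale true = *-identityˡ _
      scale false = refl

    -- Non-adjacent pairs impose no constraint; shifting one of the two forms keeps them distinct.
    gap : Vertex → Vertex → ℕ
    gap u v = not (adjacent u v) ▹ 1

    no-gap : ∀ {u v} → u ~ v → gap u v ≡ 0
    no-gap {u} {v} u~v = cong (λ b → not b ▹ 1) (dec-true (u ~? v) u~v)

    distinct : ∀ u v → (∃[ w ] (adjacent u w ▹ 1) ≢ (adjacent v w ▹ 1)) ⊎ 0 ≢ gap u v
    distinct u v with u ~? v
    ... | no _ = inj₂ λ ()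
    ... | yes u~v = inj₁ (v , λ eq → contradiction
      (trans (sym (cong (_▹ 1) (dec-true (u ~? v) u~v)))
             (trans eq (cong (_▹ 1) (dec-false (v ~? v) (~-irrefl refl))))) λ ())

    conclude : (Σ[ ℓ ∈ (Vertex → ℕ) ] (∀ v → ℓ v ∈ L v) ×
                 (∀ e → dot (proj₁ (edge e)) ℓ ≢
                        gap (proj₁ (edge e)) (proj₂ (edge e)) + dot (proj₂ (edge e)) ℓ)) →
               ∃[ ℓ ] ((∀ v → ℓ v ∈ L v) × IsAdditive ℓ)
    conclude (ℓ , ℓ∈ , differ) = ℓ , ℓ∈ , λ u v u~v eq → differ (combine u v)
      (subst (λ (u , v) → dot u ℓ ≡ gap u v + dot v ℓ) (sym (Fin.remQuot-combine u v))
        (trans (dot≡S ℓ u) (trans eq (sym (cong₂ _+_ (no-gap u~v) (dot≡S ℓ v))))))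

-- Graphs with an independent core and attached cliques.

module Cliques (c h m : ℕ) (Q : Fin h → Fin (suc m) → Fin c → Bool) where

  s : ℕ
  s = suc m

  adj : Fin c ⊎ (Fin h × Fin s) → Fin c ⊎ (Fin h × Fin s) → Bool
  adj (inj₁ _) (inj₁ _) = false
  adj (inj₁ x) (inj₂ (p , i)) = Q p i x
  adj (inj₂ (p , i)) (inj₁ x) = Q p i x
  adj (inj₂ (p , i)) (inj₂ (q , j)) = does (p Fin.≟ q) ∧ not (does (i Fin.≟ j))

  does-≟-sym : ∀ {n} (x y : Fin n) → does (x Fin.≟ y) ≡ does (y Fin.≟ x)
  does-≟-sym zero zero = refl
  does-≟-sym zero (suc y) = refl
  does-≟-sym (suc x) zero = refl
  does-≟-sym (suc x) (suc y) = does-≟-sym x y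

  adj-sym : ∀ a b → adj a b ≡ adj b a
  adj-sym (inj₁ _) (inj₁ _) = refl
  adj-sym (inj₁ _) (inj₂ _) = refl
  adj-sym (inj₂ _) (inj₁ _) = refl
  adj-sym (inj₂ (p , i)) (inj₂ (q , j)) =
    cong₂ (λ b b′ → b ∧ not b′) (does-≟-sym p q) (does-≟-sym i j)

  adj-irrefl : ∀ a → ¬ T (adj a a)
  adj-irrefl (inj₂ (p , i)) t
    rewrite dec-true (p Fin.≟ p) refl | dec-true (i Fin.≟ i) refl = t

  code : Fin (c + h * s) → Fin c ⊎ (Fin h × Fin s)
  code v = map₂ (remQuot s) (splitAt c v)

  graph : Graph
  graph = record
    { order    = c + h * s
    ; _~_      = λ v w → T (adj (code v) (code w))
    ; _~?_     = λ v w → T? (adj (code v) (code w))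
    ; ~-sym    = λ {v} {w} → subst T (adj-sym (code v) (code w))
    ; ~-irrefl = λ { {v} refl → adj-irrefl (code v) }
    }

  open Graph graph hiding (order)

  core : Fin c → Vertex
  core x = x ↑ˡ (h * s)

  node : Fin h → Fin s → Vertex
  node p i = c ↑ʳ combine p i

  code-core : ∀ x → code (core x) ≡ inj₁ x
  code-core x = cong (map₂ (remQuot s)) (Fin.splitAt-↑ˡ c x (h * s))

  code-node : ∀ p i → code (node p i) ≡ inj₂ (p , i)
  code-node p i = trans (cong (map₂ (remQuot s)) (Fin.splitAt-↑ʳ c (h * s) (combine p i)))
                        (cong inj₂ (Fin.remQuot-combine p i))

  data Kind : Vertex → Set where
    is-core : ∀ x → Kind (core x)
    is-node : ∀ p i → Kind (node p i)

  kind : ∀ v → Kind v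
  kind v with splitAt c v in eq
  ... | inj₁ x = subst Kind (Fin.splitAt⁻¹-↑ˡ eq) (is-core x)
  ... | inj₂ y with p , i , refl ← Fin.combine-surjective {h} y =
    subst Kind (Fin.splitAt⁻¹-↑ʳ {i = v} eq) (is-node p i)

  sum-adjacent : ∀ ℓ v → S ℓ v ≡
    ∑[ x < c ] adj (code v) (inj₁ x) ▹ ℓ (core x) +
    (∑[ p < h ] ∑[ i < s ] adj (code v) (inj₂ (p , i)) ▹ ℓ (node p i))
  sum-adjacent ℓ v = begin
    S ℓ v
      ≡⟨ S-weight graph ℓ v ⟩
    weight (λ w → adj (code v) (code w)) ℓ
      ≡⟨ sum-++ c _ ⟩
    (∑[ x < c ] adj (code v) (code (core x)) ▹ ℓ (core x)) +
    sum (λ y → adj (code v) (code (c ↑ʳ y)) ▹ ℓ (c ↑ʳ y))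
      ≡⟨ cong₂ _+_
           (sum-cong-≗ λ x → cong (λ a → adj (code v) a ▹ ℓ (core x)) (code-core x))
           (trans (sum-combine h _) (sum-cong-≗ λ p → sum-cong-≗ λ i →
             cong (λ a → adj (code v) a ▹ ℓ (node p i)) (code-node p i))) ⟩
    _ ∎
    where open ≡-Reasoning

  S-core : ∀ ℓ x → S ℓ (core x) ≡ ∑[ p < h ] ∑[ i < s ] Q p i x ▹ ℓ (node p i)
  S-core ℓ x = begin
    S ℓ (core x)
      ≡⟨ sum-adjacent ℓ (core x) ⟩
    ∑[ y < c ] adj (code (core x)) (inj₁ y) ▹ ℓ (core y) +
    (∑[ p < h ] ∑[ i < s ] adj (code (core x)) (inj₂ (p , i)) ▹ ℓ (node p i))
      ≡⟨ cong (λ a → ∑[ y < c ] adj a (inj₁ y) ▹ ℓ (core y) +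
                     (∑[ p < h ] ∑[ i < s ] adj a (inj₂ (p , i)) ▹ ℓ (node p i))) (code-core x) ⟩
    (∑[ y < c ] 0) + (∑[ p < h ] ∑[ i < s ] Q p i x ▹ ℓ (node p i))
      ≡⟨ cong (_+ (∑[ p < h ] ∑[ i < s ] Q p i x ▹ ℓ (node p i)))
              (trans (sum-const c) (*-zeroʳ c)) ⟩
    _ ∎
    where open ≡-Reasoning

  -- The node's own label completes the clique total without subtraction. The sums at equally
  -- labeled nodes of a clique thus differ only by core weight.
  S-node : ∀ ℓ p i → S ℓ (node p i) + ℓ (node p i) ≡
                     weight (Q p i) (ℓ ∘ core) + sum (ℓ ∘ node p)
  S-node ℓ p i = begin
    S ℓ (node p i) + ℓ (node p i)
      ≡⟨ cong (_+ ℓ (node p i)) (sum-adjacent ℓ (node p i)) ⟩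
    ∑[ x < c ] adj (code (node p i)) (inj₁ x) ▹ ℓ (core x) +
    (∑[ q < h ] ∑[ j < s ] adj (code (node p i)) (inj₂ (q , j)) ▹ ℓ (node q j)) + ℓ (node p i)
      ≡⟨ cong (λ a → ∑[ x < c ] adj a (inj₁ x) ▹ ℓ (core x) +
                     (∑[ q < h ] ∑[ j < s ] adj a (inj₂ (q , j)) ▹ ℓ (node q j)) + ℓ (node p i))
              (code-node p i) ⟩
    W + (∑[ q < h ] ∑[ j < s ] (does (p Fin.≟ q) ∧ not (does (i Fin.≟ j))) ▹ ℓ (node q j))
      + ℓ (node p i)
      ≡⟨ cong (λ z → W + z + ℓ (node p i)) (trans
           (sum-cong-≗ λ q → pull (does (p Fin.≟ q)) (λ j → not (does (i Fin.≟ j))) (ℓ ∘ node q))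
           (weight-singleton p _)) ⟩
    W + weight (λ j → not (does (i Fin.≟ j))) (ℓ ∘ node p) + ℓ (node p i)
      ≡⟨ +-assoc W _ _ ⟩
    W + (weight (λ j → not (does (i Fin.≟ j))) (ℓ ∘ node p) + ℓ (node p i))
      ≡⟨ cong (W +_) (trans (+-comm _ (ℓ (node p i)))
           (trans (cong (_+ weight (λ j → not (does (i Fin.≟ j))) (ℓ ∘ node p))
                        (sym (weight-singleton i (ℓ ∘ node p))))
                  (weight-complement (λ j → does (i Fin.≟ j)) (ℓ ∘ node p)))) ⟩
    W + sum (ℓ ∘ node p) ∎
    where
    open ≡-Reasoning
    W = weight (Q p i) (ℓ ∘ core)
    pull : ∀ b (R : Fin s → Bool) f → ∑[ j < s ] (b ∧ R j) ▹ f j ≡ b ▹ weight R f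
    pull true R f = refl
    pull false R f = trans (sum-const s) (*-zeroʳ s)

  clique-edge : ∀ p {i j} → i ≢ j → node p i ~ node p j
  clique-edge p {i} {j} i≢j
    rewrite code-node p i | code-node p j
          | dec-true (p Fin.≟ p) refl | dec-false (i Fin.≟ j) i≢j = tt

  label : (Fin c → ℕ) → Vertex → ℕ
  label f v = [ f , const 1 ]′ (splitAt c v)

  label-core : ∀ f x → label f (core x) ≡ f x
  label-core f x = cong [ f , const 1 ]′ (Fin.splitAt-↑ˡ c x (h * s))

  label-node : ∀ f p i → label f (node p i) ≡ 1
  label-node f p i = cong [ f , const 1 ]′ (Fin.splitAt-↑ʳ c (h * s) (combine p i))

  label-bounds : ∀ f {k} → 1 ≤ k → (∀ x → 1 ≤ f x × f x ≤ k) → ∀ v → 1 ≤ label f v × label f v ≤ k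
  label-bounds f 1≤k bounds v with splitAt c v
  ... | inj₁ x = bounds x
  ... | inj₂ _ = ≤-refl , 1≤k

  S-unit-node : ∀ ℓ p i → (∀ j → ℓ (node p j) ≡ 1) →
                S ℓ (node p i) ≡ weight (Q p i) (ℓ ∘ core) + m
  S-unit-node ℓ p i unit = +-cancelʳ-≡ 1 _ _ (begin
    S ℓ (node p i) + 1 ≡⟨ cong (S ℓ (node p i) +_) (unit i) ⟨
    S ℓ (node p i) + ℓ (node p i) ≡⟨ S-node ℓ p i ⟩
    W + sum (ℓ ∘ node p) ≡⟨ cong (W +_) (trans (sum-cong-≗ unit) (sum-ones s)) ⟩
    W + s ≡⟨ cong (W +_) (+-comm 1 m) ⟩
    W + (m + 1) ≡⟨ +-assoc W m 1 ⟨
    W + m + 1 ∎)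
    where
    open ≡-Reasoning
    W = weight (Q p i) (ℓ ∘ core)

  S-label-node : ∀ f p i → S (label f) (node p i) ≡ weight (Q p i) f + m
  S-label-node f p i = trans (S-unit-node (label f) p i (label-node f p))
    (cong (_+ m) (sum-cong-≗ λ x → cong (Q p i x ▹_) (label-core f x)))

  S-label-core : ∀ f x → S (label f) (core x) ≡ ∑[ p < h ] ∑[ i < s ] Q p i x ▹ 1
  S-label-core f x = trans (S-core (label f) x)
    (sum-cong-≗ λ p → sum-cong-≗ λ i → cong (Q p i x ▹_) (label-node f p i))

  -- With label 1 on all cliques every core vertex has sum `D`, so edges to the core need only `≢D`.
  -- Inside a clique the sums are core weights plus the common `m`.
  label-additive : ∀ {D} f →
    (∀ x → ∑[ p < h ] ∑[ i < s ] Q p i x ▹ 1 ≡ D) →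
    (∀ p i j → weight (Q p i) f ≡ weight (Q p j) f → i ≡ j) →
    (∀ p i → weight (Q p i) f + m ≢ D) → IsAdditive (label f)
  label-additive {D} f core-degree injective ≢D u v u~v with kind u | kind v
  ... | is-core x | is-core y = λ _ → subst T (cong₂ adj (code-core x) (code-core y)) u~v
  ... | is-core x | is-node p i = λ eq → ≢D p i
    (trans (sym (S-label-node f p i)) (trans (sym eq) (trans (S-label-core f x) (core-degree x))))
  ... | is-node p i | is-core x = λ eq → ≢D p i
    (trans (sym (S-label-node f p i)) (trans eq (trans (S-label-core f x) (core-degree x))))
  ... | is-node p i | is-node q j with p Fin.≟ q | i Fin.≟ j | subst T (cong₂ adj (code-node p i) (code-node q j)) u~v
  ... | yes refl | no i≢j | _ = λ eq → i≢j (injective p i j (+-cancelʳ-≡ m _ _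
    (trans (sym (S-label-node f p i)) (trans eq (S-label-node f p j)))))

-- The majority labels of the three classes, whose intervals of labels are consecutive.
record IsValues (m : ℕ) (v : Fin 3 → ℕ) : Set where
  field
    v₀<v₁ : v zero < v (suc zero)
    v₁<v₂ : v (suc zero) < v (suc (suc zero))
    v₂≤ : v (suc (suc zero)) ≤ 3 * m

-- The graph of all guesses and its lower bound for lists.

module Construction (m M ω : ℕ)
  (size : (Fin 3 → ℕ) → Fin (suc m) → Fin 3 → ℕ)
  (padding : (Fin 3 → ℕ) → ℕ)
  (size≤M : ∀ {v} → IsValues m v → ∀ i t → size v i t ≤ M)
  (padding≤ω : ∀ {v} → IsValues m v → padding v ≤ ω)
  where

  -- `n` exceeds `m * M`, as `majority` requires. `G` counts the maps from the `3 * n` class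
  -- vertices to `Fin m`, and `D` will be the core degree.
  n c G D : ℕ
  n = suc (m * M)
  c = 3 * n + ω
  G = m ^ (3 * n)
  D = G * suc m

  class : Fin 3 → Fin n → Fin c
  class t y = combine t y ↑ˡ ω

  pad : Fin ω → Fin c
  pad z = 3 * n ↑ʳ z

  colour : Fin G → Fin 3 → Fin n → Fin m
  colour g t y = finToFun {m} {3 * n} g (combine t y)

  abstract
    main : ∀ g t → ∃[ a ] M ≤ count λ y → does (colour g t y Fin.≟ a)
    main g t = majority ≤-refl (colour g t)

  value : Fin G → Fin 3 → ℕ
  value g t = suc (toℕ t * m + toℕ (proj₁ (main g t)))

  values : ∀ g → IsValues m (value g)
  values g = record
    { v₀<v₁ = s≤s (climb zero (suc zero) refl)
    ; v₁<v₂ = s≤s (climb (suc zero) (suc (suc zero)) refl)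
    ; v₂≤ = top
    }
    where
    open ≤-Reasoning
    climb : ∀ t t′ → toℕ t′ ≡ suc (toℕ t) →
            toℕ t * m + toℕ (proj₁ (main g t)) < toℕ t′ * m + toℕ (proj₁ (main g t′))
    climb t t′ eq = begin-strict
      toℕ t * m + toℕ (proj₁ (main g t)) <⟨ +-monoʳ-< (toℕ t * m) (Fin.toℕ<n _) ⟩
      toℕ t * m + m ≡⟨ +-comm (toℕ t * m) m ⟩
      suc (toℕ t) * m ≡⟨ cong (_* m) eq ⟨
      toℕ t′ * m ≤⟨ m≤m+n _ _ ⟩
      toℕ t′ * m + toℕ (proj₁ (main g t′)) ∎
    top : value g (suc (suc zero)) ≤ 3 * m
    top = begin
      suc (2 * m + toℕ (proj₁ (main g (suc (suc zero))))) ≤⟨ +-monoʳ-< (2 * m) (Fin.toℕ<n _) ⟩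
      2 * m + m ≡⟨ +-comm (2 * m) m ⟩
      3 * m ∎

  in-majority : Fin G → (t : Fin 3) → Fin n → Bool
  in-majority g t y = does (colour g t y Fin.≟ proj₁ (main g t))

  chosen : Fin G → Fin (suc m) → Fin 3 → Fin n → Bool
  chosen g i t = select (in-majority g t) (size (value g) i t)

  padded : Fin G → Fin ω → Bool
  padded g = select (const true) (padding (value g))

  P : Fin G → Fin (suc m) → Fin c → Bool
  P g i x = [ uncurry (chosen g i) ∘ remQuot n , padded g ]′ (splitAt (3 * n) x)

  -- Between P g i and its complement every core vertex is counted once, whence core-degree.
  Q : Fin (G + G) → Fin (suc m) → Fin c → Bool
  Q p i x = [ (λ g → P g i x) , (λ g → not (P g i x)) ]′ (splitAt G p)

  open Cliques c (G + G) m Q public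
  open Graph graph public hiding (order)

  sum-core : ∀ f → sum f ≡ (∑[ t < 3 ] ∑[ y < n ] f (class t y)) + sum (f ∘ pad)
  sum-core f = trans (sum-++ (3 * n) f)
    (cong (_+ sum (f ∘ pad)) (sum-combine 3 {n} (λ x → f (x ↑ˡ ω))))

  count-chosen : ∀ g i t → count (chosen g i t) ≡ size (value g) i t
  count-chosen g i t = count-select (in-majority g t) (≤-trans (size≤M (values g) i t) (proj₂ (main g t)))

  count-padded : ∀ g → count (padded g) ≡ padding (value g)
  count-padded g = count-select {ω} (const true) (subst (padding (value g) ≤_)
    (sym (sum-ones ω)) (padding≤ω (values g)))

  -- Only vertices of the main colour are chosen in a class, so `f` has to be known only there. This
  -- admits an arbitrary labeling that follows the guess `g`.
  weight-P : ∀ g i f (a : Fin 3 → ℕ) →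
    (∀ t y → colour g t y ≡ proj₁ (main g t) → f (class t y) ≡ a t) →
    weight (P g i) f ≡ (∑[ t < 3 ] (size (value g) i t * a t)) + weight (padded g) (f ∘ pad)
  weight-P g i f a f≡a = trans (sum-core (λ x → P g i x ▹ f x)) (cong₂ _+_
    (sum-cong-≗ λ t → begin
      (∑[ y < n ] P g i (class t y) ▹ f (class t y))
        ≡⟨ sum-cong-≗ (λ y → cong (_▹ f (class t y)) (P-class t y)) ⟩
      weight (chosen g i t) (f ∘ class t)
        ≡⟨ weight-const (chosen g i t) (λ y hit → f≡a t y (of-main t y (select-⊆ (in-majority g t) (size (value g) i t) y hit))) ⟩
      count (chosen g i t) * a t
        ≡⟨ cong (_* a t) (count-chosen g i t) ⟩
      size (value g) i t * a t ∎)
    (sum-cong-≗ λ z → cong (_▹ f (pad z)) (P-pad z)))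
    where
    open ≡-Reasoning
    P-class : ∀ t y → P g i (class t y) ≡ chosen g i t y
    P-class t y = trans
      (cong [ uncurry (chosen g i) ∘ remQuot n , padded g ]′ (Fin.splitAt-↑ˡ (3 * n) (combine t y) ω))
      (cong (uncurry (chosen g i)) (Fin.remQuot-combine t y))
    P-pad : ∀ z → P g i (pad z) ≡ padded g z
    P-pad z = cong [ uncurry (chosen g i) ∘ remQuot n , padded g ]′ (Fin.splitAt-↑ʳ (3 * n) ω z)
    of-main : ∀ t y → does (colour g t y Fin.≟ proj₁ (main g t)) ≡ true →
              colour g t y ≡ proj₁ (main g t)
    of-main t y hit with yes eq ← colour g t y Fin.≟ proj₁ (main g t) = eq

  Q-left : ∀ g i x → Q (g ↑ˡ G) i x ≡ P g i x
  Q-left g i x =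
    cong [ (λ g → P g i x) , (λ g → not (P g i x)) ]′ (Fin.splitAt-↑ˡ G g G)

  Q-right : ∀ g i x → Q (G ↑ʳ g) i x ≡ not (P g i x)
  Q-right g i x =
    cong [ (λ g → P g i x) , (λ g → not (P g i x)) ]′ (Fin.splitAt-↑ʳ G G g)

  weight-left : ∀ g i f → weight (Q (g ↑ˡ G) i) f ≡ weight (P g i) f
  weight-left g i f = weight-cong {f = f} (Q-left g i)

  weight-right : ∀ g i f → weight (P g i) f + weight (Q (G ↑ʳ g) i) f ≡ sum f
  weight-right g i f =
    trans (cong (weight (P g i) f +_) (weight-cong {f = f} (Q-right g i))) (weight-complement (P g i) f)

  core-degree : ∀ x → (∑[ p < G + G ] ∑[ i < s ] Q p i x ▹ 1) ≡ D
  core-degree x = begin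
    (∑[ p < G + G ] ∑[ i < s ] Q p i x ▹ 1)
      ≡⟨ sum-++ G _ ⟩
    (∑[ g < G ] ∑[ i < s ] Q (g ↑ˡ G) i x ▹ 1) + (∑[ g < G ] ∑[ i < s ] Q (G ↑ʳ g) i x ▹ 1)
      ≡⟨ cong₂ _+_ (sum-cong-≗ λ g → sum-cong-≗ λ i → cong (_▹ 1) (Q-left g i x))
                   (sum-cong-≗ λ g → sum-cong-≗ λ i → cong (_▹ 1) (Q-right g i x)) ⟩
    (∑[ g < G ] ∑[ i < s ] P g i x ▹ 1) + (∑[ g < G ] ∑[ i < s ] not (P g i x) ▹ 1)
      ≡⟨ ∑-distrib-+ (λ g → ∑[ i < s ] P g i x ▹ 1) (λ g → ∑[ i < s ] not (P g i x) ▹ 1) ⟨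
    (∑[ g < G ] ((∑[ i < s ] P g i x ▹ 1) + (∑[ i < s ] not (P g i x) ▹ 1)))
      ≡⟨ sum-cong-≗ (λ g → trans (weight-complement (λ i → P g i x) (const 1))
                                 (sum-ones s)) ⟩
    (∑[ g < G ] s)
      ≡⟨ sum-const G ⟩
    D ∎
    where open ≡-Reasoning

  by-side : (A : Fin (G + G) → Set) → (∀ g → A (g ↑ˡ G)) → (∀ g → A (G ↑ʳ g)) → ∀ p → A p
  by-side A left right p with splitAt G p in eq
  ... | inj₁ g = subst A (Fin.splitAt⁻¹-↑ˡ eq) (left g)
  ... | inj₂ g = subst A (Fin.splitAt⁻¹-↑ʳ {i = p} eq) (right g)

  additive : ∀ f → (∀ g i j → weight (P g i) f ≡ weight (P g j) f → i ≡ j) →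
             (∀ p i → weight (Q p i) f + m ≢ D) → IsAdditive (label f)
  additive f injective = label-additive f core-degree injective′
    where
    injective′ : ∀ p i j → weight (Q p i) f ≡ weight (Q p j) f → i ≡ j
    injective′ = by-side _
      (λ g i j eq → injective g i j (trans (sym (weight-left g i f)) (trans eq (weight-left g j f))))
      -- Weights on complementary sets add up to `sum f`, so equality for the complements gives
      -- equality for the sets `P`.
      (λ g i j eq → injective g i j (+-cancelʳ-≡ (weight (Q (G ↑ʳ g) i) f) _ _
        (trans (weight-right g i f)
               (sym (trans (cong (weight (P g j) f +_) eq) (weight-right g j f))))))

  core-base : Fin c → ℕ
  core-base x = [ (λ ty → suc (toℕ (proj₁ (remQuot {3} n ty)) * m)) , const 1 ]′ (splitAt (3 * n) x)

  -- Each list will consist of consecutive integers from `base v` on, so a choice from it amounts to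
  -- an offset.
  base : Vertex → ℕ
  base = label core-base

  base-class : ∀ t y → base (core (class t y)) ≡ suc (toℕ t * m)
  base-class t y = trans (label-core core-base (class t y)) (trans
    (cong [ (λ ty → suc (toℕ (proj₁ (remQuot {3} n ty)) * m)) , const 1 ]′
          (Fin.splitAt-↑ˡ (3 * n) (combine t y) ω))
    (cong (λ ty → suc (toℕ (proj₁ ty) * m)) (Fin.remQuot-combine t y)))

  base-positive : ∀ v → 1 ≤ base v
  base-positive v with splitAt c v
  ... | inj₂ _ = ≤-refl
  ... | inj₁ x with splitAt (3 * n) x
  ... | inj₁ _ = s≤s z≤n
  ... | inj₂ _ = ≤-refl

  module _ (balanced : ∀ {v} → IsValues m v → ∀ i j →
              (∑[ t < 3 ] (size v i t * v t)) ≡ (∑[ t < 3 ] (size v j t * v t))) where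

    not-additive : ∀ ℓ (κ : Vertex → Fin m) → (∀ v → ℓ v ≡ base v + toℕ (κ v)) → ¬ IsAdditive ℓ
    not-additive ℓ κ ℓ≡ ℓ-additive =
      ℓ-additive (node p i) (node p j) (clique-edge p (Fin.<⇒≢ i<j)) (+-cancelʳ-≡ (ℓ (node p i)) _ _ (begin
        S ℓ (node p i) + ℓ (node p i) ≡⟨ S-node ℓ p i ⟩
        weight (Q p i) (ℓ ∘ core) + sum (ℓ ∘ node p)
          ≡⟨ cong (_+ sum (ℓ ∘ node p)) (trans (core-weight i)
               (trans (cong (_+ weight (padded g) (ℓ ∘ core ∘ pad)) (balanced (values g) i j)) (sym (core-weight j)))) ⟩
        weight (Q p j) (ℓ ∘ core) + sum (ℓ ∘ node p) ≡⟨ S-node ℓ p j ⟨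
        S ℓ (node p j) + ℓ (node p j) ≡⟨ cong (S ℓ (node p j) +_) same-label ⟨
        S ℓ (node p j) + ℓ (node p i) ∎))
      where
      open ≡-Reasoning
      -- The offsets used on the classes are themselves a guess; additivity fails on the first of
      -- its two cliques.
      g = funToFin {3 * n} {m} (λ ty → κ (core (ty ↑ˡ ω)))
      p = g ↑ˡ G
      collision = Fin.pigeonhole ≤-refl (κ ∘ node p)
      i = proj₁ collision
      j = proj₁ (proj₂ collision)
      i<j = proj₁ (proj₂ (proj₂ collision))

      same-label : ℓ (node p i) ≡ ℓ (node p j)
      same-label = trans (ℓ≡ (node p i)) (trans
        (cong₂ _+_ (trans (label-node core-base p i) (sym (label-node core-base p j)))
                   (cong toℕ (proj₂ (proj₂ (proj₂ collision)))))
        (sym (ℓ≡ (node p j))))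

      majority-label : ∀ t y → colour g t y ≡ proj₁ (main g t) → ℓ (core (class t y)) ≡ value g t
      majority-label t y eq = trans (ℓ≡ (core (class t y))) (cong₂ _+_ (base-class t y)
        (cong toℕ (trans (sym (Fin.finToFun-funToFin (λ ty → κ (core (ty ↑ˡ ω))) (combine t y))) eq)))

      core-weight : ∀ k → weight (Q p k) (ℓ ∘ core) ≡
        (∑[ t < 3 ] (size (value g) k t * value g t)) + weight (padded g) (ℓ ∘ core ∘ pad)
      core-weight k = trans (weight-left g k (ℓ ∘ core)) (weight-P g k (ℓ ∘ core) (value g) majority-label)

    no-short-lists : ∀ {j} → j ≤ m → ¬ HasListAdditiveLabelings graph j
    no-short-lists {j} j≤m choose
      with ℓ , ℓ∈ , ℓ-additive ← choose (λ v → tabulate {n = j} (λ a → base v + toℕ a)) (λ v → record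
        { size = length-tabulate _
        ; distinct = Unique.tabulate⁺ (λ eq → Fin.toℕ-injective (+-cancelˡ-≡ (base v) _ _ eq))
        ; positive = All.tabulate⁺ (λ a → ≤-trans (base-positive v) (m≤m+n _ _))
        })
      = not-additive ℓ (λ v → inject≤ (proj₁ (∈-tabulate⁻ (ℓ∈ v))) j≤m)
          (λ v → trans (proj₂ (∈-tabulate⁻ (ℓ∈ v))) (cong (base v +_) (sym (Fin.toℕ-inject≤ _ j≤m))))
          ℓ-additive

    ηₗ≥ : ∀ {k} → k ≤ suc m → ηₗ graph ≥ k
    ηₗ≥ k≤1+m = record
      { inhabited = _ , s≤s z≤n , large-lists graph
      ; lowerBound = λ j _ works → ≤-trans k≤1+m (≰⇒> λ j≤m → no-short-lists j≤m works)
      }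

-- Makes the number `G` of guesses exceed the number `3 * n` of class vertices.
n<m^n : ∀ {m} → 2 ≤ m → ∀ n → n < m ^ n
n<m^n 2≤m zero = s≤s z≤n
n<m^n {m} 2≤m (suc n) = begin-strict
  suc n ≤⟨ n<m^n 2≤m n ⟩
  m ^ n <⟨ m<m+n (m ^ n) (≤-<-trans z≤n (n<m^n 2≤m n)) ⟩
  m ^ n + m ^ n ≡⟨ cong (m ^ n +_) (+-identityʳ (m ^ n)) ⟨
  2 * m ^ n ≤⟨ *-monoˡ-≤ (m ^ n) 2≤m ⟩
  m * m ^ n ∎
  where open ≤-Reasoning

module _ {m : ℕ} where

  -- Complementary multipliers with constant sum `suc m`; the shift keeps `lower` positive.
  lower upper : Fin (suc m) → ℕ
  lower i = suc (toℕ i)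
  upper i = m ∸ toℕ i

  lower+upper : ∀ i → lower i + upper i ≡ suc m
  lower+upper i = cong suc (m+[n∸m]≡n (s≤s⁻¹ (Fin.toℕ<n i)))

  lower≤ : ∀ i → lower i ≤ suc m
  lower≤ i = Fin.toℕ<n i

  upper≤ : ∀ i → upper i ≤ suc m
  upper≤ i = ≤-trans (m∸n≤m m (toℕ i)) (n≤1+n m)

  lower-injective : ∀ {d} → 0 < d → ∀ i j → d * lower i ≡ d * lower j → i ≡ j
  lower-injective {d} 0<d i j eq =
    Fin.toℕ-injective (suc-injective (*-cancelˡ-≡ (lower i) (lower j) d {{>-nonZero 0<d}} eq))

-- Part (i): core neighbourhoods of distinct sizes.

module Unequal (m : ℕ) (2≤m : 2 ≤ m) where

  -- a * (b * l) + b * (a * u) = a * b * (m + 1) when l + u = m + 1.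
  size : (Fin 3 → ℕ) → Fin (suc m) → Fin 3 → ℕ
  size v i 0F = 0
  size v i 1F = v 2F * lower i
  size v i 2F = v 1F * upper i

  size≤ : ∀ {v} → IsValues m v → ∀ i t → size v i t ≤ 3 * m * suc m
  size≤ vals i 0F = z≤n
  size≤ vals i 1F = *-mono-≤ (IsValues.v₂≤ vals) (lower≤ i)
  size≤ vals i 2F =
    *-mono-≤ (≤-trans (<⇒≤ (IsValues.v₁<v₂ vals)) (IsValues.v₂≤ vals)) (upper≤ i)

  open Construction m (3 * m * suc m) 0 size (const 0) size≤ (λ _ → z≤n) public

  balanced : ∀ {v} → IsValues m v → ∀ i j →
             (∑[ t < 3 ] (size v i t * v t)) ≡ (∑[ t < 3 ] (size v j t * v t))
  balanced {v} _ i j = trans (total i) (sym (total j))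
    where
    identity : ∀ a b l u → b * l * a + (a * u * b + 0) ≡ a * b * (l + u)
    identity = solve-∀
    total : ∀ i → (∑[ t < 3 ] (size v i t * v t)) ≡ v 1F * v 2F * suc m
    total i = trans (identity (v 1F) (v 2F) (lower i) (upper i))
                    (cong (v 1F * v 2F *_) (lower+upper i))

  -- Writing `v 2F` as `v 1F` plus a positive gap leaves only the gap times `lower i` depending on
  -- `i`, so the size of `P g i` determines `i`.
  weight-P-1 : ∀ g i → let v = value g in
    weight (P g i) (const 1) ≡ v 1F * suc m + (v 2F ∸ v 1F) * lower i + count (padded g)
  weight-P-1 g i = trans (weight-P g i (const 1) (const 1) (λ _ _ _ → refl))
    (cong (_+ count (padded g)) (begin
      v 2F * lower i * 1 + (v 1F * upper i * 1 + 0)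
        ≡⟨ cong (λ b → b * lower i * 1 + (v 1F * upper i * 1 + 0))
                (m+[n∸m]≡n (<⇒≤ (IsValues.v₁<v₂ (values g)))) ⟨
      (v 1F + (v 2F ∸ v 1F)) * lower i * 1 + (v 1F * upper i * 1 + 0)
        ≡⟨ identity (v 1F) (v 2F ∸ v 1F) (lower i) (upper i) ⟩
      v 1F * (lower i + upper i) + (v 2F ∸ v 1F) * lower i
        ≡⟨ cong (λ k → v 1F * k + (v 2F ∸ v 1F) * lower i) (lower+upper i) ⟩
      v 1F * suc m + (v 2F ∸ v 1F) * lower i ∎))
    where
    open ≡-Reasoning
    v = value g
    identity : ∀ a d l u → (a + d) * l * 1 + (a * u * 1 + 0) ≡ a * (l + u) + d * l
    identity = solve-∀

  ones-additive : IsAdditive (label (const 1))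
  -- Under the all-one labeling a clique vertex has sum at most `c + m`, which is below `D` because
  -- `G` exceeds the order `c` of the core.
  ones-additive = additive (const 1) injective λ p i → <⇒≢ (begin-strict
    weight (Q p i) (const 1) + m ≤⟨ +-monoˡ-≤ m (weight≤sum (Q p i) (const 1)) ⟩
    sum {c} (const 1) + m ≡⟨ cong (_+ m) (trans (sum-ones c) (+-identityʳ (3 * n))) ⟩
    3 * n + m <⟨ +-monoˡ-< m (n<m^n 2≤m (3 * n)) ⟩
    G + m ≤⟨ +-monoʳ-≤ G (subst (_≤ G * m) (*-identityˡ m) (*-monoˡ-≤ m (≤-<-trans z≤n (n<m^n 2≤m (3 * n))))) ⟩
    G + G * m ≡⟨ *-suc G m ⟨
    D ∎)
    where
    open ≤-Reasoning
    injective : ∀ g i j → weight (P g i) (const 1) ≡ weight (P g j) (const 1) → i ≡ j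
    injective g i j eq = lower-injective (m<n⇒0<n∸m (IsValues.v₁<v₂ (values g))) i j
      (+-cancelˡ-≡ (value g 1F * suc m) _ _ (+-cancelʳ-≡ (count (padded g)) _ _
        (trans (sym (weight-P-1 g i)) (trans eq (weight-P-1 g j)))))

  η≡1 : η graph ≡ 1
  η≡1 = record
    { isPositive = ≤-refl
    ; holds = label (const 1) , label-bounds (const 1) ≤-refl (λ _ → ≤-refl , ≤-refl) , ones-additive
    ; least = λ _ 1≤j _ → 1≤j
    }

-- Part (ii): core neighbourhoods of equal size.

module Balanced (m : ℕ) (2≤m : 2 ≤ m) where

  -- X is the number of core neighbours of every clique vertex; the padding of order ω brings
  -- the order of the core to 2 * X, so that P g i and its complement can both have X elements.
  M′ n′ X ω : ℕ
  M′ = 3 * m * suc m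
  n′ = suc (m * M′)
  X = m ^ (3 * n′) * suc m ∸ m
  ω = 2 * X ∸ 3 * n′

  spread : (Fin 3 → ℕ) → ℕ
  spread v = (v 1F ∸ v 0F) + (v 2F ∸ v 1F)

  -- The direction (v₁ − v₂ , v₂ − v₀ , v₀ − v₁) is orthogonal to (1 , 1 , 1) and to v.
  size : (Fin 3 → ℕ) → Fin (suc m) → Fin 3 → ℕ
  size v i 0F = (v 2F ∸ v 1F) * upper i
  size v i 1F = spread v * lower i
  size v i 2F = (v 1F ∸ v 0F) * upper i

  -- The three sizes add up to `spread v * suc m` for every `i`; the padding completes `P g i` to
  -- `X` vertices.
  padding : (Fin 3 → ℕ) → ℕ
  padding v = X ∸ spread v * suc m

  m≤G*m : m ≤ m ^ (3 * n′) * m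
  m≤G*m = subst (_≤ m ^ (3 * n′) * m) (*-identityˡ m) (*-monoˡ-≤ m (≤-<-trans z≤n (n<m^n 2≤m (3 * n′))))

  -- Ensures that `ω` is at least `X`, enough for any padding.
  3n≤X : 3 * n′ ≤ X
  3n≤X = begin
    3 * n′ ≤⟨ <⇒≤ (n<m^n 2≤m (3 * n′)) ⟩
    g ≡⟨ m+n∸n≡m g m ⟨
    g + m ∸ m ≤⟨ ∸-monoˡ-≤ m (+-monoʳ-≤ g m≤G*m) ⟩
    g + g * m ∸ m ≡⟨ cong (_∸ m) (*-suc g m) ⟨
    X ∎
    where
    open ≤-Reasoning
    g = m ^ (3 * n′)

  -- Matches the degree of a clique vertex, with `X` core neighbours and `m` others, to the core
  -- degree.
  X+m : X + m ≡ m ^ (3 * n′) * suc m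
  X+m = m∸n+n≡m (≤-trans m≤G*m (*-monoʳ-≤ (m ^ (3 * n′)) (n≤1+n m)))

  M<n : M′ < n′
  M<n = s≤s (subst (_≤ m * M′) (*-identityˡ M′) (*-monoˡ-≤ M′ (<⇒≤ 2≤m)))

  module _ {v} (vals : IsValues m v) where
    open IsValues vals

    v₁≡ : v 0F + (v 1F ∸ v 0F) ≡ v 1F
    v₁≡ = m+[n∸m]≡n (<⇒≤ v₀<v₁)

    v₂≡ : v 0F + spread v ≡ v 2F
    v₂≡ = trans (sym (+-assoc (v 0F) _ _)) (trans (cong (_+ (v 2F ∸ v 1F)) v₁≡) (m+[n∸m]≡n (<⇒≤ v₁<v₂)))

    spread≤ : spread v ≤ 3 * m
    spread≤ = ≤-trans (m≤n+m (spread v) (v 0F)) (≤-trans (≤-reflexive v₂≡) v₂≤)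

    spread>0 : 0 < spread v
    spread>0 = <-≤-trans (m<n⇒0<n∸m v₀<v₁) (m≤m+n _ _)

    size≤ : ∀ i t → size v i t ≤ M′
    size≤ i 0F = *-mono-≤ (≤-trans (m≤n+m (v 2F ∸ v 1F) (v 1F ∸ v 0F)) spread≤) (upper≤ i)
    size≤ i 1F = *-mono-≤ spread≤ (lower≤ i)
    size≤ i 2F = *-mono-≤ (≤-trans (m≤m+n (v 1F ∸ v 0F) (v 2F ∸ v 1F)) spread≤) (upper≤ i)

    spread*≤X : spread v * suc m ≤ X
    spread*≤X = ≤-trans (*-monoˡ-≤ (suc m) spread≤)
      (≤-trans (<⇒≤ M<n) (≤-trans (m≤m+n n′ (2 * n′)) 3n≤X))

    padding≤ω : padding v ≤ ω
    padding≤ω = ≤-trans (m∸n≤m X (spread v * suc m)) (begin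
      X ≡⟨ m+n∸n≡m X X ⟨
      X + X ∸ X ≤⟨ ∸-monoʳ-≤ (X + X) 3n≤X ⟩
      X + X ∸ 3 * n′ ≡⟨ cong (λ x → X + x ∸ 3 * n′) (+-identityʳ X) ⟨
      ω ∎)
      where open ≤-Reasoning

    padding+ : spread v * suc m + padding v ≡ X
    padding+ = m+[n∸m]≡n spread*≤X

    weighted-total : ∀ i → (∑[ t < 3 ] (size v i t * v t)) ≡ v 1F * spread v * suc m
    weighted-total i = begin
      β * u * e + (σ * l * v 1F + (α * u * v 2F + 0))
        ≡⟨ cong₂ (λ a b → β * u * e + (σ * l * a + (α * u * b + 0))) v₁≡ v₂≡ ⟨
      β * u * e + (σ * l * (e + α) + (α * u * (e + σ) + 0))
        ≡⟨ identity e α β l u ⟩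
      (e + α) * σ * (l + u)
        ≡⟨ cong₂ (λ a k → a * σ * k) v₁≡ (lower+upper i) ⟩
      v 1F * σ * suc m ∎
      where
      open ≡-Reasoning
      e = v 0F
      α = v 1F ∸ v 0F
      β = v 2F ∸ v 1F
      σ = spread v
      l = lower i
      u = upper i
      identity : ∀ e α β l u →
        β * u * e + ((α + β) * l * (e + α) + (α * u * (e + (α + β)) + 0)) ≡
        (e + α) * (α + β) * (l + u)
      identity = solve-∀

  open Construction m M′ ω size padding size≤ padding≤ω public

  balanced : ∀ {v} → IsValues m v → ∀ i j →
             (∑[ t < 3 ] (size v i t * v t)) ≡ (∑[ t < 3 ] (size v j t * v t))
  balanced vals i j = trans (weighted-total vals i) (sym (weighted-total vals j))

  c≡2X : c ≡ 2 * X
  c≡2X = m+[n∸m]≡n (≤-trans 3n≤X (m≤m+n X (X + 0)))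

  middle : Fin 3 → ℕ
  middle t = does (t Fin.≟ 1F) ▹ 1

  f : Fin c → ℕ
  f x = [ (λ ty → suc (middle (proj₁ (remQuot {3} n ty)))) , const 1 ]′ (splitAt (3 * n) x)

  f-class : ∀ t y → f (class t y) ≡ suc (middle t)
  f-class t y = trans
    (cong [ (λ ty → suc (middle (proj₁ (remQuot {3} n ty)))) , const 1 ]′
          (Fin.splitAt-↑ˡ (3 * n) (combine t y) ω))
    (cong (λ ty → suc (middle (proj₁ ty))) (Fin.remQuot-combine t y))

  f-pad : ∀ z → f (pad z) ≡ 1
  f-pad z = cong [ (λ ty → suc (middle (proj₁ (remQuot {3} n ty)))) , const 1 ]′
                 (Fin.splitAt-↑ʳ (3 * n) ω z)

  1≤f≤2 : ∀ x → 1 ≤ f x × f x ≤ 2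
  1≤f≤2 x with splitAt (3 * n) x
  ... | inj₂ _ = ≤-refl , s≤s z≤n
  ... | inj₁ ty with proj₁ (remQuot {3} n ty)
  ... | 0F = ≤-refl , s≤s z≤n
  ... | 1F = s≤s z≤n , ≤-refl
  ... | 2F = ≤-refl , s≤s z≤n

  sum-f : sum f ≡ 2 * X + n
  sum-f = begin
    sum f ≡⟨ sum-core f ⟩
    (∑[ t < 3 ] ∑[ y < n ] f (class t y)) + sum (f ∘ pad)
      ≡⟨ cong₂ _+_
           (sum-cong-≗ λ t → trans (sum-cong-≗ (f-class t)) (sum-const n))
           (trans (sum-cong-≗ f-pad) (sum-ones ω)) ⟩
    n * 1 + (n * 2 + (n * 1 + 0)) + ω ≡⟨ identity n ω ⟩
    3 * n + ω + n ≡⟨ cong (_+ n) c≡2X ⟩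
    2 * X + n ∎
    where
    open ≡-Reasoning
    identity : ∀ n ω → n * 1 + (n * 2 + (n * 1 + 0)) + ω ≡ 3 * n + ω + n
    identity = solve-∀

  -- For `a = 1` this is the weight under `f`, for `a = 0` the number of vertices. Ones on the
  -- classes and the padding together give `X`; the surplus on class 1 carries the dependence on
  -- `i`.
  weight-P-middle : ∀ g i (a : ℕ) (h : Fin c → ℕ) → (∀ t y → h (class t y) ≡ 1 + (does (t Fin.≟ 1F) ▹ a)) →
    (∀ z → h (pad z) ≡ 1) → weight (P g i) h ≡ X + size (value g) i 1F * a
  weight-P-middle g i a h h-class h-pad = begin
    weight (P g i) h
      ≡⟨ weight-P g i h (λ t → 1 + (does (t Fin.≟ 1F) ▹ a)) (λ t y _ → h-class t y) ⟩
    β * u * 1 + (σ * l * (1 + a) + (α * u * 1 + 0)) + weight (padded g) (h ∘ pad)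
      ≡⟨ cong₂ _+_ (identity α β l u a) (trans (weight-ones (padded g) (h ∘ pad) h-pad) (count-padded g)) ⟩
    σ * (l + u) + σ * l * a + padding v
      ≡⟨ cong (λ k → σ * k + σ * l * a + padding v) (lower+upper i) ⟩
    σ * suc m + σ * l * a + padding v
      ≡⟨ swap (σ * suc m) (σ * l * a) (padding v) ⟩
    σ * suc m + padding v + σ * l * a
      ≡⟨ cong (_+ σ * l * a) (padding+ (values g)) ⟩
    X + σ * l * a ∎
    where
    open ≡-Reasoning
    v = value g
    α = v 1F ∸ v 0F
    β = v 2F ∸ v 1F
    σ = spread v
    l = lower i
    u = upper i
    identity : ∀ α β l u a → β * u * 1 + ((α + β) * l * (1 + a) + (α * u * 1 + 0)) ≡
                             (α + β) * (l + u) + (α + β) * l * a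
    identity = solve-∀
    swap : ∀ x y z → x + y + z ≡ x + z + y
    swap = solve-∀

  weight-P-f : ∀ g i → weight (P g i) f ≡ X + size (value g) i 1F
  weight-P-f g i = trans (weight-P-middle g i 1 f f-class f-pad) (cong (X +_) (*-identityʳ _))

  count-P : ∀ g i → count (P g i) ≡ X
  count-P g i = trans (weight-P-middle g i 0 (const 1) (λ t _ → cong suc (sym (▹0 (does (t Fin.≟ 1F))))) (λ _ → refl))
    (trans (cong (X +_) (*-zeroʳ (size (value g) i 1F))) (+-identityʳ X))
    where
    ▹0 : ∀ b → b ▹ 0 ≡ 0
    ▹0 true = refl
    ▹0 false = refl

  count-Q : ∀ p i → count (Q p i) ≡ X
  count-Q = by-side _
    (λ g i → trans (weight-left g i (const 1)) (count-P g i))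
    (λ g i → +-cancelˡ-≡ X _ _ (begin
      X + count (Q (G ↑ʳ g) i) ≡⟨ cong (_+ count (Q (G ↑ʳ g) i)) (count-P g i) ⟨
      count (P g i) + count (Q (G ↑ʳ g) i) ≡⟨ weight-right g i (const 1) ⟩
      sum {c} (const 1) ≡⟨ sum-ones c ⟩
      c ≡⟨ c≡2X ⟩
      X + (X + 0) ≡⟨ cong (X +_) (+-identityʳ X) ⟩
      X + X ∎))
    where open ≡-Reasoning

  size₁>0 : ∀ g i → 0 < size (value g) i 1F
  size₁>0 g i = *-mono-≤ (spread>0 (values g)) (s≤s (z≤n {toℕ i}))

  -- As `X + m` is the core degree, this separates clique vertices from the core. For a complement,
  -- `X + s₁` is taken away from `2 * X + n`, where `s₁ ≤ M′ < n`.
  weight-Q-f>X : ∀ p i → X < weight (Q p i) f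
  weight-Q-f>X = by-side _
    (λ g i → subst (X <_) (sym (trans (weight-left g i f) (weight-P-f g i))) (m<m+n X (size₁>0 g i)))
    (λ g i → let s₁ = size (value g) i 1F in +-cancelˡ-< (X + s₁) _ _ (begin-strict
      X + s₁ + X <⟨ +-monoˡ-< X (+-monoʳ-< X (≤-<-trans (size≤ (values g) i 1F) M<n)) ⟩
      X + n + X ≡⟨ swap X n ⟩
      2 * X + n ≡⟨ sum-f ⟨
      sum f ≡⟨ weight-right g i f ⟨
      weight (P g i) f + weight (Q (G ↑ʳ g) i) f ≡⟨ cong (_+ weight (Q (G ↑ʳ g) i) f) (weight-P-f g i) ⟩
      X + s₁ + weight (Q (G ↑ʳ g) i) f ∎))
    where
    open ≤-Reasoning
    swap : ∀ x n → x + n + x ≡ 2 * x + n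
    swap = solve-∀

  f-additive : IsAdditive (label f)
  f-additive = additive f injective λ p i eq →
    <⇒≢ (+-monoˡ-< m (weight-Q-f>X p i)) (trans X+m (sym eq))
    where
    injective : ∀ g i j → weight (P g i) f ≡ weight (P g j) f → i ≡ j
    injective g i j eq = lower-injective (spread>0 (values g)) i j
      (+-cancelˡ-≡ X _ _ (trans (sym (weight-P-f g i)) (trans eq (weight-P-f g j))))

  S-ones : ∀ v → S (const 1) v ≡ D
  S-ones v = go (kind v)
    where
    go : ∀ {v} → Kind v → S (const 1) v ≡ D
    go (is-core x) = trans (S-core (const 1) x) (core-degree x)
    go (is-node p i) =
      trans (S-unit-node (const 1) p i (λ _ → refl)) (trans (cong (_+ m) (count-Q p i)) X+m)

  regular : Regular graph
  regular = D , λ v → trans (degree≡S graph v) (S-ones v)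

  -- By regularity the all-one labeling gives every vertex the same sum, so a single edge refutes
  -- it.
  not-1 : ¬ HasAdditiveLabeling graph 1
  not-1 (ℓ , bounds , ℓ-additive) =
    ℓ-additive (node p 0F) (node p (suc x₀)) (clique-edge p λ ())
      (trans (S-const (node p 0F)) (sym (S-const (node p (suc x₀)))))
    where
    x₀ : Fin m
    x₀ = fromℕ< (<⇒≤ 2≤m)
    p = funToFin {3 * n} {m} (const x₀) ↑ˡ G
    S-const : ∀ v → S ℓ v ≡ D
    S-const v = trans (S-weight graph ℓ v) (trans
      (weight-ones (adjacent graph v) ℓ (λ w → ≤-antisym (proj₂ (bounds w)) (proj₁ (bounds w))))
      (trans (sym (S-weight graph (const 1) v)) (S-ones v)))

  η≡2 : η graph ≡ 2
  η≡2 = record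
    { isPositive = s≤s z≤n
    ; holds = label f , label-bounds f (s≤s z≤n) 1≤f≤2 , f-additive
    ; least = λ { 1 _ works → contradiction works not-1 ; (suc (suc j)) _ _ → s≤s (s≤s z≤n) }
    }

theorem1 : ∀ (k : ℕ) → 2 ≤ k →
    (∃[ G ] ((η G ≡ 1) × (ηₗ G ≥ k))) ×
    (∃[ H ] (Regular H × (η H ≡ 2) × (ηₗ H ≥ k)))
theorem1 k 2≤k =
  -- With `m = k` the bound reached is `suc k`, one more than required; `m = k ∸ 1` would break
  -- `2 ≤ m` at `k = 2`.
  (U.graph , U.η≡1 , U.ηₗ≥ U.balanced (n≤1+n k)) ,
  (R.graph , R.regular , R.η≡2 , R.ηₗ≥ R.balanced (n≤1+n k))
  where
  module U = Unequal k 2≤k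
  module R = Balanced k 2≤k
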